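{- Let $S$ be a symmetric conference matrix of order $4n+2\geq 6$. Then (i) $\mathfrak H_S(4n+2,4,5)$ is a $3$-$(4n+2,4,3n)$ design; (ii) $\mathfrak H_S(4n+2,4,-3)$ is a $3$-$(4n+2,4,n-1)$ design.
   Context: A symmetric conference matrix of order $m$ is an $m\times m$ symmetric matrix $S$ with zero diagonal and all off-diagonal entries in $\{ -1,1\}$ such that $SS^{\top}=(m-1)I$. For a $v\times v$ matrix $A$, $\mathfrak H_A(v,k,a)$ is the $k$-uniform hypergraph with vertex set $[v]=\{1,\dots,v\}$ whose hyperedges are the $k$-subsets $\alpha\subset[v]$ with $\det(A[\alpha])=a$, where $A[\alpha]$ is the principal submatrix of $A$ indexed by $\alpha$. For positive integers $t,v,k,\lambda$, a $t$-$(v,k,\lambda)$ design is a $k$-uniform hypergraph on a $v$-element vertex set with the property that any set of $t$ vertices appear together in precisely $\lambda$ hyperedges. -}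

module Defs where

open import Data.Bool.Base using (true; false; if_then_else_)
open import Data.Fin.Base using (Fin; zero; suc; toℕ; punchIn)
open import Data.Fin.Properties using (_≟_)
open import Data.Fin.Subset using (Subset; ∣_∣; _⊆_)
open import Data.Integer.Base using (ℤ; +_; 0ℤ; 1ℤ; -1ℤ; _+_; _*_; _-_; _^_)
open import Data.Integer.Properties using (+-*-semiring)
open import Data.List.Base using (List; length)
open import Data.List.Membership.Propositional using (_∈_)
open import Data.List.Relation.Unary.Unique.Propositional using (Unique)
open import Data.Nat.Base using (ℕ; zero; suc)
open import Data.Product.Base using (∃-syntax; _×_; _,_; proj₁)
open import Data.Sum.Base using (_⊎_)
open import Data.Vec.Base using ([]; _∷_)
open import Data.Vec.Functional using (Vector)
open import Function.Bundles using (_⇔_)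
open import Relation.Binary.PropositionalEquality using (_≡_; _≢_)
open import Relation.Nullary.Decidable.Core using (⌊_⌋)

open import Algebra.Properties.Semiring.Sum +-*-semiring using (sum)

Matrix : ℕ → Set
Matrix n = Vector (Vector ℤ n) n

_ᵀ : ∀ {n} → Matrix n → Matrix n
(A ᵀ) i j = A j i

_⊗_ : ∀ {n} → Matrix n → Matrix n → Matrix n
(A ⊗ B) i j = sum (λ k → A i k * B k j)

identity : ∀ {n} → Matrix n
identity i j = if ⌊ i ≟ j ⌋ then 1ℤ else 0ℤ

_·_ : ∀ {n} → ℤ → Matrix n → Matrix n
(c · A) i j = c * A i j

-- Equality of matrices is entrywise, since function extensionality is not
-- available.
_≐_ : ∀ {n} → Matrix n → Matrix n → Set
A ≐ B = ∀ i j → A i j ≡ B i j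

-- Laplace expansion along the first row; `punchIn j` skips column j.
det : ∀ {n} → Matrix n → ℤ
det {zero}  A = 1ℤ
det {suc n} A =
  sum (λ j → -1ℤ ^ toℕ j * (A zero j * det (λ r c → A (suc r) (punchIn j c))))

-- The elements of α in increasing order.
element : ∀ {n} (α : Subset n) → Fin ∣ α ∣ → Fin n
element (true  ∷ α) zero    = zero
element (true  ∷ α) (suc i) = suc (element α i)
element (false ∷ α) i       = suc (element α i)

_[_] : ∀ {n} → Matrix n → (α : Subset n) → Matrix ∣ α ∣
(A [ α ]) i j = A (element α i) (element α j)

record IsSymmetricConference {m : ℕ} (S : Matrix m) : Set where
  field
    symmetric    : (S ᵀ) ≐ S
    zeroDiagonal : ∀ i → S i i ≡ 0ℤ
    offDiagonal  : ∀ i j → i ≢ j → S i j ≡ -1ℤ ⊎ S i j ≡ 1ℤ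
    conference   : (S ⊗ (S ᵀ)) ≐ ((+ m - 1ℤ) · identity)

record UniformHypergraph (v k : ℕ) : Set₁ where
  field
    Edge    : Subset v → Set
    uniform : ∀ α → Edge α → ∣ α ∣ ≡ k

open UniformHypergraph public

𝓗 : ∀ {v} → Matrix v → (k : ℕ) → ℤ → UniformHypergraph v k
𝓗 A k a = record
  { Edge    = λ α → ∣ α ∣ ≡ k × det (A [ α ]) ≡ a
  ; uniform = λ _ → proj₁
  }

-- Exactly c subsets satisfy P.  Counting with a duplicate-free list rather than
-- with a bijection between Fin c and ∃ P counts the subsets themselves, not the
-- proofs of P.
HasCount : ∀ {v} → (Subset v → Set) → ℕ → Set
HasCount {v} P c =
  ∃[ αs ] (Unique αs × length αs ≡ c × (∀ (α : Subset v) → α ∈ αs ⇔ P α))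

-- The parameters are not required to be positive: in particular the index may
-- be 0, meaning that no t-set of vertices lies in a hyperedge.
IsDesign : (t v k index : ℕ) → UniformHypergraph v k → Set
IsDesign t v k index H =
  ∀ (τ : Subset v) → ∣ τ ∣ ≡ t → HasCount (λ α → Edge H α × τ ⊆ α) index

{-# OPTIONS --safe #-}
-- Fix three vertices i, j, k and put X = S ij S kl, Y = S ik S jl,
-- Z = S jk S il.  For l outside {i,j,k} these are signs, and the principal
-- minor on {i,j,k,l} is X² + Y² + Z² − 2w = 3 − 2w with w = XY + XZ + YZ, so
-- w is 3 or −1 and the minor is −3 or 5 respectively.  For l in {i,j,k}
-- exactly one of XY, XZ, YZ survives and w = 1.  As a function of l,
-- w is a combination of products of two distinct rows of S, so it sums to 0.
-- With A and B the numbers of l with w = 3 and w = −1 this gives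
-- A + B + 3 = 4n + 2 and 3A − B + 3 = 0, so A = n − 1 and B = 3n.
module Submission where

open import Defs
open import Data.Bool.Base using (true; false; not)
open import Data.Bool.Properties using (not-¬)
open import Data.Fin.Base using (Fin; zero; suc; toℕ; punchIn)
import Data.Fin.Properties as Fin
open import Data.Fin.Subset using (Subset; ∣_∣; _⊆_; _∈_; _∉_)
open import Data.Fin.Subset.Properties using (drop-there; drop-∷-⊆; _∈?_)
open import Data.Integer.Base
  using (ℤ; +_; -_; 0ℤ; 1ℤ; -1ℤ; _^_)
  renaming (_+_ to _+ᶻ_; _*_ to _*ᶻ_; _-_ to _-ᶻ_)
open import Data.Integer.Properties as ℤ using (+-*-semiring)
open import Data.Integer.Solver using (module +-*-Solver)
open import Data.List.Base using (List; []; _∷_; length; map; filter; tabulate; allFin; insertAt)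
open import Data.List.Membership.Propositional using () renaming (_∈_ to _∈ₗ_)
open import Data.List.Membership.Propositional.Properties
  using (∈-map⁺; ∈-map⁻; ∈-tabulate⁺; ∈-tabulate⁻; ∈-filter⁺; ∈-filter⁻; ∈-allFin)
open import Data.List.Membership.Propositional.Properties.WithK using (unique∧set⇒bag)
open import Data.List.Properties using (length-map; length-tabulate)
open import Data.List.Relation.Binary.BagAndSetEquality using (∼bag⇒↭)
open import Data.List.Relation.Binary.Permutation.Propositional.Properties using (↭-length)
open import Data.List.Relation.Unary.All using ([]; _∷_)
open import Data.List.Relation.Unary.AllPairs using ([]; _∷_)
open import Data.List.Relation.Unary.Any using (here; there)
open import Data.List.Relation.Unary.Unique.Propositional using (Unique)
import Data.List.Relation.Unary.Unique.Propositional.Properties as Unique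
open import Data.Nat.Base using (ℕ; zero; suc; _+_; _*_; _∸_; _≤_)
import Data.Nat.Properties as ℕ
import Data.Nat.Solver as ℕ
open import Data.Product.Base using (_×_; _,_; ∃; proj₁; proj₂)
open import Data.Sum.Base using (_⊎_; inj₁; inj₂)
open import Data.Vec.Base using ([]; _∷_; updateAt; here; there)
import Data.Vec.Functional as V
open import Data.Vec.Properties using (∷-injectiveˡ; ∷-injectiveʳ)
open import Function.Base using (_∘_; id)
open import Function.Bundles using (mk⇔)
open import Relation.Binary.PropositionalEquality hiding ([_])
open import Relation.Nullary.Decidable.Core using (yes; no)
open import Relation.Nullary.Negation using (¬_; contradiction)

open import Algebra.Properties.Semiring.Sum +-*-semiring
  using (sum; sum-cong-≗; ∑-distrib-+; *-distribˡ-sum)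
open import Algebra.Properties.AbelianGroup ℤ.+-0-abelianGroup
  using () renaming (∙-cancelˡ to +-cancelˡ)
open +-*-Solver using (Polynomial; solve; con; _:+_; _:*_; _:-_; _:=_)

private
  variable
    v k : ℕ
    A   : Set

-- Subsets

members : Subset v → List (Fin v)
members α = tabulate (element α)

-- Used to add a vertex outside `τ`. Flipping the bit, rather than setting it, makes the map
-- injective in `l` with no condition on `l`.
toggle : Subset v → Fin v → Subset v
toggle τ l = updateAt τ l not

element-∈ : ∀ (α : Subset v) s → element α s ∈ α
element-∈ (true  ∷ α) zero    = here
element-∈ (true  ∷ α) (suc s) = there (element-∈ α s)
element-∈ (false ∷ α) s       = there (element-∈ α s)

∈-element : ∀ {α : Subset v} {l} → l ∈ α → ∃ λ s → l ≡ element α s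
∈-element {α = true  ∷ α} here        = zero , refl
∈-element {α = true  ∷ α} (there l∈α) with s , eq ← ∈-element l∈α = suc s , cong suc eq
∈-element {α = false ∷ α} (there l∈α) with s , eq ← ∈-element l∈α = s , cong suc eq

element-injective : ∀ (α : Subset v) {s t} → element α s ≡ element α t → s ≡ t
element-injective (true  ∷ α) {zero}  {zero}  _  = refl
element-injective (true  ∷ α) {suc s} {suc t} eq =
  cong suc (element-injective α (Fin.suc-injective eq))
element-injective (false ∷ α) eq = element-injective α (Fin.suc-injective eq)

members-unique : ∀ (α : Subset v) → Unique (members α)
members-unique α = Unique.tabulate⁺ (element-injective α)

∈⇒∈-members : ∀ {α : Subset v} {l} → l ∈ α → l ∈ₗ members α
∈⇒∈-members {α = α} l∈α with s , refl ← ∈-element l∈α = ∈-tabulate⁺ s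

∈-members⇒∈ : ∀ {α : Subset v} {l} → l ∈ₗ members α → l ∈ α
∈-members⇒∈ {α = α} l∈ with s , refl ← ∈-tabulate⁻ l∈ = element-∈ α s

toggle-injective : ∀ (τ : Subset v) {l m} → toggle τ l ≡ toggle τ m → l ≡ m
toggle-injective (b ∷ τ) {zero}  {zero}  _  = refl
toggle-injective (b ∷ τ) {zero}  {suc m} eq = contradiction (sym (∷-injectiveˡ eq)) (not-¬ refl)
toggle-injective (b ∷ τ) {suc l} {zero}  eq = contradiction (∷-injectiveˡ eq) (not-¬ refl)
toggle-injective (b ∷ τ) {suc l} {suc m} eq = cong suc (toggle-injective τ (∷-injectiveʳ eq))

⊆-toggle : ∀ {τ : Subset v} {l} → l ∉ τ → τ ⊆ toggle τ l
⊆-toggle {l = zero}  l∉τ here        = contradiction here l∉τ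
⊆-toggle {l = suc l} l∉τ here        = here
⊆-toggle {l = zero}  l∉τ (there x∈τ) = there x∈τ
⊆-toggle {l = suc l} l∉τ (there x∈τ) = there (⊆-toggle (l∉τ ∘ there) x∈τ)

-- Members are listed in increasing order, so the new vertex lands at some position `r` that depends
-- on `τ`. The function `f` is arbitrary because the recursion on the tail composes it with `suc`.
tabulate-toggle : ∀ (f : Fin v → A) (τ : Subset v) l → l ∉ τ →
  ∃ λ r → tabulate (f ∘ element (toggle τ l)) ≡ insertAt (tabulate (f ∘ element τ)) r (f l)
tabulate-toggle f (true  ∷ τ) zero    l∉τ = contradiction here l∉τ
tabulate-toggle f (false ∷ τ) zero    l∉τ = zero , refl
tabulate-toggle f (true  ∷ τ) (suc l) l∉τ
  with r , eq ← tabulate-toggle (f ∘ suc) τ l (l∉τ ∘ there) = suc r , cong (f zero ∷_) eq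
tabulate-toggle f (false ∷ τ) (suc l) l∉τ = tabulate-toggle (f ∘ suc) τ l (l∉τ ∘ there)

∣toggle∣ : ∀ (τ : Subset v) l → l ∉ τ → ∣ toggle τ l ∣ ≡ suc ∣ τ ∣
∣toggle∣ (true  ∷ τ) zero    l∉τ = contradiction here l∉τ
∣toggle∣ (false ∷ τ) zero    l∉τ = refl
∣toggle∣ (true  ∷ τ) (suc l) l∉τ = cong suc (∣toggle∣ τ l (l∉τ ∘ there))
∣toggle∣ (false ∷ τ) (suc l) l∉τ = ∣toggle∣ τ l (l∉τ ∘ there)

⊆∧∣∣≤⇒≡ : ∀ {p q : Subset v} → p ⊆ q → ∣ q ∣ ≤ ∣ p ∣ → p ≡ q
⊆∧∣∣≤⇒≡ {p = []}        {[]}        p⊆q q≤p = refl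
⊆∧∣∣≤⇒≡ {p = true ∷ p}  {true ∷ q}  p⊆q q≤p =
  cong (true ∷_) (⊆∧∣∣≤⇒≡ (drop-∷-⊆ p⊆q) (ℕ.≤-pred q≤p))
⊆∧∣∣≤⇒≡ {p = true ∷ p}  {false ∷ q} p⊆q q≤p with () ← p⊆q here
⊆∧∣∣≤⇒≡ {p = false ∷ p} {true ∷ q}  p⊆q q≤p
  -- The tails coincide, so the bound would read `suc ∣ p ∣ ≤ ∣ p ∣`.
  with refl ← ⊆∧∣∣≤⇒≡ (drop-∷-⊆ p⊆q) (ℕ.<⇒≤ q≤p) = contradiction q≤p ℕ.1+n≰n
⊆∧∣∣≤⇒≡ {p = false ∷ p} {false ∷ q} p⊆q q≤p =
  cong (false ∷_) (⊆∧∣∣≤⇒≡ (drop-∷-⊆ p⊆q) q≤p)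

⊆⇒toggle : ∀ {τ α : Subset v} → τ ⊆ α → ∣ α ∣ ≡ suc ∣ τ ∣ →
  ∃ λ l → l ∉ τ × α ≡ toggle τ l
⊆⇒toggle {τ = []}        {[]}        τ⊆α ()
⊆⇒toggle {τ = true ∷ τ}  {false ∷ α} τ⊆α eq with () ← τ⊆α here
⊆⇒toggle {τ = true ∷ τ}  {true ∷ α}  τ⊆α eq
  with l , l∉τ , refl ← ⊆⇒toggle (drop-∷-⊆ τ⊆α) (ℕ.suc-injective eq)
  = suc l , l∉τ ∘ drop-there , refl
-- The first differing bit is the added vertex; the remaining tails are nested and equally large,
-- hence equal.
⊆⇒toggle {τ = false ∷ τ} {true ∷ α}  τ⊆α eq
  with refl ← ⊆∧∣∣≤⇒≡ (drop-∷-⊆ τ⊆α) (ℕ.≤-reflexive (ℕ.suc-injective eq))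
  = zero , (λ ()) , refl
⊆⇒toggle {τ = false ∷ τ} {false ∷ α} τ⊆α eq
  with l , l∉τ , refl ← ⊆⇒toggle (drop-∷-⊆ τ⊆α) eq
  = suc l , l∉τ ∘ drop-there , refl

-- Principal minors of order 4

det-cong : ∀ {n} {A B : Matrix n} → A ≐ B → det A ≡ det B
det-cong {zero}  A≐B = refl
det-cong {suc n} A≐B = sum-cong-≗ λ j → cong₂ (λ x y → -1ℤ ^ toℕ j *ᶻ (x *ᶻ y))
  (A≐B zero j) (det-cong λ r c → A≐B (suc r) (punchIn j c))

-- The arguments are the entries 12, 13, 14, 23, 24, 34 of a symmetric matrix.
weight : (a b c d e f : ℤ) → ℤ
weight a b c d e f =
  (a *ᶻ b) *ᶻ (f *ᶻ e) +ᶻ ((a *ᶻ d) *ᶻ (f *ᶻ c) +ᶻ (b *ᶻ d) *ᶻ (e *ᶻ c))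

-- The polynomial counterparts of weight and det reify both sides of
-- identities for the ring solver.
weightPolynomial : (a b c d e f : Polynomial v) → Polynomial v
weightPolynomial a b c d e f =
  (a :* b) :* (f :* e) :+ ((a :* d) :* (f :* c) :+ (b :* d) :* (e :* c))

detPolynomial : V.Vector (V.Vector (Polynomial v) k) k → Polynomial v
detPolynomial {k = zero}  A = con 1ℤ
detPolynomial {k = suc k} A = V.foldr _:+_ (con 0ℤ) λ j →
  con (-1ℤ ^ toℕ j) :* (A zero j :* detPolynomial (λ r c → A (suc r) (punchIn j c)))

-- Polymorphic in the entries, so that one shape serves both the integers and the polynomials of the
-- ring solver.
symmetricMatrix : (o a b c d e f : A) → V.Vector (V.Vector A 4) 4
symmetricMatrix o a b c d e f =
      (o V.∷ a V.∷ b V.∷ c V.∷ V.[])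
  V.∷ (a V.∷ o V.∷ d V.∷ e V.∷ V.[])
  V.∷ (b V.∷ d V.∷ o V.∷ f V.∷ V.[])
  V.∷ (c V.∷ e V.∷ f V.∷ o V.∷ V.[])
  V.∷ V.[]

-- With a zero diagonal only the nine derangements contribute: the three products of two disjoint
-- transpositions give the squares, and the six 4-cycles, which are odd, give each term of `weight`
-- twice.
det-symmetricMatrix : ∀ a b c d e f → det (symmetricMatrix 0ℤ a b c d e f) ≡
  (a *ᶻ f) *ᶻ (a *ᶻ f) +ᶻ (b *ᶻ e) *ᶻ (b *ᶻ e) +ᶻ (c *ᶻ d) *ᶻ (c *ᶻ d)
  -ᶻ + 2 *ᶻ weight a b c d e f
det-symmetricMatrix = solve 6 (λ a b c d e f →
  detPolynomial (symmetricMatrix (con 0ℤ) a b c d e f) :=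
  (((a :* f) :* (a :* f) :+ (b :* e) :* (b :* e)) :+ (c :* d) :* (c :* d))
  :- con (+ 2) :* weightPolynomial a b c d e f) refl

-- Arithmetic of signs

IsSign : ℤ → Set
IsSign x = x ≡ -1ℤ ⊎ x ≡ 1ℤ

sign-* : ∀ {x y} → IsSign x → IsSign y → IsSign (x *ᶻ y)
sign-* (inj₁ refl) (inj₁ refl) = inj₂ refl
sign-* (inj₁ refl) (inj₂ refl) = inj₁ refl
sign-* (inj₂ refl) (inj₁ refl) = inj₁ refl
sign-* (inj₂ refl) (inj₂ refl) = inj₂ refl

sign-square : ∀ {x} → IsSign x → x *ᶻ x ≡ 1ℤ
sign-square (inj₁ refl) = refl
sign-square (inj₂ refl) = refl

-- Since (x + y + z)² = 3 + 2w, the value is 3 when all three signs agree and -1 otherwise.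
sign-pairs : ∀ {x y z} → IsSign x → IsSign y → IsSign z →
  let w = x *ᶻ y +ᶻ (x *ᶻ z +ᶻ y *ᶻ z) in w ≡ + 3 ⊎ w ≡ -1ℤ
sign-pairs (inj₁ refl) (inj₁ refl) (inj₁ refl) = inj₁ refl
sign-pairs (inj₁ refl) (inj₁ refl) (inj₂ refl) = inj₂ refl
sign-pairs (inj₁ refl) (inj₂ refl) (inj₁ refl) = inj₂ refl
sign-pairs (inj₁ refl) (inj₂ refl) (inj₂ refl) = inj₂ refl
sign-pairs (inj₂ refl) (inj₁ refl) (inj₁ refl) = inj₂ refl
sign-pairs (inj₂ refl) (inj₁ refl) (inj₂ refl) = inj₂ refl
sign-pairs (inj₂ refl) (inj₂ refl) (inj₁ refl) = inj₂ refl
sign-pairs (inj₂ refl) (inj₂ refl) (inj₂ refl) = inj₁ refl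

-- `weight` is grouped for summation: factors without the fourth index first, then two entries with
-- it. Here the factors are regrouped by the three perfect matchings of four points, which yields
-- signs to which `sign-pairs` applies.
weight-pairs : ∀ a b c d e f → weight a b c d e f ≡
  let x = a *ᶻ f; y = b *ᶻ e; z = c *ᶻ d in x *ᶻ y +ᶻ (x *ᶻ z +ᶻ y *ᶻ z)
weight-pairs = solve 6 (λ a b c d e f → weightPolynomial a b c d e f :=
  (a :* f) :* (b :* e) :+ ((a :* f) :* (c :* d) :+ (b :* e) :* (c :* d))) refl

-- Counting by value

count : (A → ℤ) → List A → ℤ → ℕ
count f xs c = length (filter (λ x → f x ℤ.≟ c) xs)

ValueCounts : ∀ {n} → (A → ℤ) → (Fin n → A) → Set
ValueCounts {n = n} f g = let # = count f (tabulate g) in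
  n ≡ # (+ 3) + (# -1ℤ + # 1ℤ) ×
  sum (f ∘ g) ≡ + 3 *ᶻ + # (+ 3) +ᶻ (-1ℤ *ᶻ + # -1ℤ +ᶻ + # 1ℤ)

value-counts : ∀ {n} (f : A → ℤ) (g : Fin n → A) →
  (∀ x → f x ≡ + 3 ⊎ f x ≡ -1ℤ ⊎ f x ≡ 1ℤ) → ValueCounts f g
value-counts {n = zero}  f g value = refl , refl
value-counts {n = suc n} f g value = step (value-counts f (g ∘ suc) value)
  where
  # : ℤ → ℕ
  # = count f (tabulate (g ∘ suc))
  step : ValueCounts f (g ∘ suc) → ValueCounts f g
  -- Once the head value is a literal, the three filters compute and exactly one count grows by one.
  step (size , total) with f (g zero) | value (g zero)
  ... | _ | inj₁ refl        = cong suc size ,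
    trans (cong (+ 3 +ᶻ_) total)
      (solve 3 (λ a b c → con (+ 3) :+ (con (+ 3) :* a :+ (con -1ℤ :* b :+ c)) :=
        con (+ 3) :* (con 1ℤ :+ a) :+ (con -1ℤ :* b :+ c)) refl
        (+ # (+ 3)) (+ # -1ℤ) (+ # 1ℤ))
  ... | _ | inj₂ (inj₁ refl) = trans (cong suc size) (sym (ℕ.+-suc (# (+ 3)) _)) ,
    trans (cong (-1ℤ +ᶻ_) total)
      (solve 3 (λ a b c → con -1ℤ :+ (con (+ 3) :* a :+ (con -1ℤ :* b :+ c)) :=
        con (+ 3) :* a :+ (con -1ℤ :* (con 1ℤ :+ b) :+ c)) refl
        (+ # (+ 3)) (+ # -1ℤ) (+ # 1ℤ))
  ... | _ | inj₂ (inj₂ refl) =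
    trans (cong suc size) (sym (trans
      (cong (λ m → # (+ 3) + m) (ℕ.+-suc (# -1ℤ) (# 1ℤ)))
      (ℕ.+-suc (# (+ 3)) (# -1ℤ + # 1ℤ)))) ,
    trans (cong (1ℤ +ᶻ_) total)
      (solve 3 (λ a b c → con 1ℤ :+ (con (+ 3) :* a :+ (con -1ℤ :* b :+ c)) :=
        con (+ 3) :* a :+ (con -1ℤ :* b :+ (con 1ℤ :+ c))) refl
        (+ # (+ 3)) (+ # -1ℤ) (+ # 1ℤ))

count-solution : ∀ n {A B} → 4 * n + 2 ≡ A + (B + 3) →
  0ℤ ≡ + 3 *ᶻ + A +ᶻ (-1ℤ *ᶻ + B +ᶻ + 3) → A ≡ n ∸ 1 × B ≡ 3 * n
count-solution n {A} {B} size total =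
  -- Truncated subtraction is exact here, since `n` is the successor of `A`.
  cong (_∸ 1) (sym n≡1+A) , trans B≡3[1+A] (cong (3 *_) (sym n≡1+A))
  where
  module ℕS = ℕ.+-*-Solver
  open ≡-Reasoning

  B≡3[1+A] : B ≡ 3 * suc A
  B≡3[1+A] = ℤ.+-injective (begin
    + B                                        ≡⟨ ℤ.+-identityˡ (+ B) ⟨
    0ℤ +ᶻ + B                                  ≡⟨ cong (_+ᶻ + B) total ⟩
    (+ 3 *ᶻ + A +ᶻ (-1ℤ *ᶻ + B +ᶻ + 3)) +ᶻ + B ≡⟨ solve 2 (λ a b →
      (con (+ 3) :* a :+ (con -1ℤ :* b :+ con (+ 3))) :+ b :=
      con (+ 3) :* (con 1ℤ :+ a)) refl (+ A) (+ B) ⟩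
    + 3 *ᶻ + suc A                             ≡⟨ ℤ.pos-* 3 (suc A) ⟨
    + (3 * suc A)                              ∎)

  n≡1+A : n ≡ suc A
  n≡1+A = ℕ.*-cancelˡ-≡ n (suc A) 4 (ℕ.+-cancelʳ-≡ 2 _ _ (begin
    4 * n + 2             ≡⟨ size ⟩
    A + (B + 3)           ≡⟨ cong (λ b → A + (b + 3)) B≡3[1+A] ⟩
    A + (3 * suc A + 3)   ≡⟨ ℕS.solve 1 (λ a →
      a ℕS.:+ (ℕS.con 3 ℕS.:* (ℕS.con 1 ℕS.:+ a) ℕS.:+ ℕS.con 3) ℕS.:=
      ℕS.con 4 ℕS.:* (ℕS.con 1 ℕS.:+ a) ℕS.:+ ℕS.con 2) refl A ⟩
    4 * suc A + 2         ∎))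

-- Conference matrices

module _ {v} {S : Matrix v} (C : IsSymmetricConference S) where
  open IsSymmetricConference C

  rows-orthogonal : ∀ {i j} → i ≢ j → sum (λ l → S i l *ᶻ S j l) ≡ 0ℤ
  rows-orthogonal {i} {j} i≢j with i Fin.≟ j | conference i j
  ... | yes i≡j | _  = contradiction i≡j i≢j
  ... | no  _   | eq = trans eq (ℤ.*-zeroʳ (+ v -ᶻ 1ℤ))

  weightAt : (i j k l : Fin v) → ℤ
  weightAt i j k l = weight (S i j) (S i k) (S i l) (S j k) (S j l) (S k l)

  sum-weightAt : ∀ {i j k} → Unique (i ∷ j ∷ k ∷ []) → sum (weightAt i j k) ≡ 0ℤ
  sum-weightAt {i} {j} {k} ((i≢j ∷ i≢k ∷ []) ∷ (j≢k ∷ []) ∷ [] ∷ []) = begin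
    sum (weightAt i j k)            ≡⟨ ∑-distrib-+ X (λ l → Y l +ᶻ Z l) ⟩
    sum X +ᶻ sum (λ l → Y l +ᶻ Z l) ≡⟨ cong (sum X +ᶻ_) (∑-distrib-+ Y Z) ⟩
    sum X +ᶻ (sum Y +ᶻ sum Z)       ≡⟨ cong₂ _+ᶻ_ (scaled (S i j *ᶻ S i k) (≢-sym j≢k))
                                         (cong₂ _+ᶻ_ (scaled (S i j *ᶻ S j k) (≢-sym i≢k))
                                                     (scaled (S i k *ᶻ S j k) (≢-sym i≢j))) ⟩
    0ℤ                              ∎
    where
    open ≡-Reasoning
    X Y Z : Fin v → ℤ
    X l = (S i j *ᶻ S i k) *ᶻ (S k l *ᶻ S j l)
    Y l = (S i j *ᶻ S j k) *ᶻ (S k l *ᶻ S i l)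
    Z l = (S i k *ᶻ S j k) *ᶻ (S j l *ᶻ S i l)
    scaled : ∀ x {p q} → p ≢ q → sum (λ l → x *ᶻ (S p l *ᶻ S q l)) ≡ 0ℤ
    scaled x {p} {q} p≢q = begin
      sum (λ l → x *ᶻ (S p l *ᶻ S q l)) ≡⟨ *-distribˡ-sum x (λ l → S p l *ᶻ S q l) ⟨
      x *ᶻ sum (λ l → S p l *ᶻ S q l)   ≡⟨ cong (x *ᶻ_) (rows-orthogonal p≢q) ⟩
      x *ᶻ 0ℤ                           ≡⟨ ℤ.*-zeroʳ x ⟩
      0ℤ                                ∎

  product-square : ∀ {p q r s} → p ≢ q → r ≢ s →
    (S p q *ᶻ S r s) *ᶻ (S p q *ᶻ S r s) ≡ 1ℤ
  product-square p≢q r≢s = sign-square (sign-* (offDiagonal _ _ p≢q) (offDiagonal _ _ r≢s))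

  weightAt-outside : ∀ {i j k l} → Unique (i ∷ j ∷ k ∷ []) → ¬ l ∈ₗ i ∷ j ∷ k ∷ [] →
    weightAt i j k l ≡ + 3 ⊎ weightAt i j k l ≡ -1ℤ
  weightAt-outside {i} {j} {k} {l} ((i≢j ∷ i≢k ∷ []) ∷ (j≢k ∷ []) ∷ [] ∷ []) l∉
    rewrite weight-pairs (S i j) (S i k) (S i l) (S j k) (S j l) (S k l) = sign-pairs
      (sign-* (offDiagonal i j i≢j) (offDiagonal k l (λ k≡l → l∉ (there (there (here (sym k≡l)))))))
      (sign-* (offDiagonal i k i≢k) (offDiagonal j l (λ j≡l → l∉ (there (here (sym j≡l))))))
      (sign-* (offDiagonal i l (λ i≡l → l∉ (here (sym i≡l)))) (offDiagonal j k j≢k))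

  -- Orthogonality of rows sums over all vertices, so the contribution of the triple itself must be
  -- known. A diagonal zero kills two of the three terms, and by symmetry the third is the square of
  -- a sign.
  weightAt-inside : ∀ {i j k l} → Unique (i ∷ j ∷ k ∷ []) → l ∈ₗ i ∷ j ∷ k ∷ [] →
    weightAt i j k l ≡ 1ℤ
  weightAt-inside {i} {j} {k} ((i≢j ∷ i≢k ∷ []) ∷ _) (here refl)
    rewrite zeroDiagonal i | symmetric i j | symmetric i k = trans
      (solve 3 (λ a b d →
        weightPolynomial a b (con 0ℤ) d a b := (a :* b) :* (a :* b)) refl (S i j) (S i k) (S j k))
      (product-square i≢j i≢k)
  weightAt-inside {i} {j} {k} ((i≢j ∷ _) ∷ (j≢k ∷ []) ∷ _) (there (here refl))
    rewrite zeroDiagonal j | symmetric j k = trans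
      (solve 3 (λ a b d →
        weightPolynomial a b a d (con 0ℤ) d := (a :* d) :* (a :* d)) refl (S i j) (S i k) (S j k))
      (product-square i≢j j≢k)
  weightAt-inside {i} {j} {k} ((_ ∷ i≢k ∷ []) ∷ (j≢k ∷ []) ∷ _) (there (there (here refl)))
    rewrite zeroDiagonal k = trans
      (solve 3 (λ a b d →
        weightPolynomial a b b d d (con 0ℤ) := (b :* d) :* (b :* d)) refl (S i j) (S i k) (S j k))
      (product-square i≢k j≢k)

  -- The size `k` is general because it will be the cardinality of a subset, which does not compute
  -- to 4; the list equation forces it. The constant 3 is the sum of three squares of signs.
  det-weightAt : ∀ {k} (f : Fin k → Fin v) {a b c d} → Unique (tabulate f) →
    tabulate f ≡ a ∷ b ∷ c ∷ d ∷ [] →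
    det (λ r s → S (f r) (f s)) ≡ + 3 -ᶻ + 2 *ᶻ weightAt a b c d
  det-weightAt {4} f {a} {b} {c} {d}
    ((a≢b ∷ a≢c ∷ a≢d ∷ []) ∷ (b≢c ∷ b≢d ∷ []) ∷ (c≢d ∷ []) ∷ [] ∷ []) refl = begin
    det (λ r s → S (f r) (f s))
      ≡⟨ det-cong entries ⟩
    det (symmetricMatrix 0ℤ (S a b) (S a c) (S a d) (S b c) (S b d) (S c d))
      ≡⟨ det-symmetricMatrix (S a b) (S a c) (S a d) (S b c) (S b d) (S c d) ⟩
    _ ≡⟨ cong (_-ᶻ + 2 *ᶻ weightAt a b c d) (cong₂ _+ᶻ_ (cong₂ _+ᶻ_
           (product-square a≢b c≢d) (product-square a≢c b≢d)) (product-square a≢d b≢c)) ⟩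
    + 3 -ᶻ + 2 *ᶻ weightAt a b c d ∎
    where
    open ≡-Reasoning
    entries : (λ r s → S (f r) (f s)) ≐
      symmetricMatrix 0ℤ (S a b) (S a c) (S a d) (S b c) (S b d) (S c d)
    entries zero                   zero                   = zeroDiagonal a
    entries zero                   (suc zero)             = refl
    entries zero                   (suc (suc zero))       = refl
    entries zero                   (suc (suc (suc zero))) = refl
    entries (suc zero)             zero                   = symmetric a b
    entries (suc zero)             (suc zero)             = zeroDiagonal b
    entries (suc zero)             (suc (suc zero))       = refl
    entries (suc zero)             (suc (suc (suc zero))) = refl
    entries (suc (suc zero))       zero                   = symmetric a c
    entries (suc (suc zero))       (suc zero)             = symmetric b c
    entries (suc (suc zero))       (suc (suc zero))       = zeroDiagonal c
    entries (suc (suc zero))       (suc (suc (suc zero))) = refl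
    entries (suc (suc (suc zero))) zero                   = symmetric a d
    entries (suc (suc (suc zero))) (suc zero)             = symmetric b d
    entries (suc (suc (suc zero))) (suc (suc zero))       = symmetric c d
    entries (suc (suc (suc zero))) (suc (suc (suc zero))) = zeroDiagonal d

  -- The position of `l` is immaterial: permuting the four vertices permutes the three perfect
  -- matchings, and `weight` is symmetric in their products. The list `xs` is tied to the triple by
  -- an equation because the type of `r` depends on its length.
  det-insertAt : ∀ {k} (f : Fin k → Fin v) {xs i j k l} → Unique (tabulate f) →
    xs ≡ i ∷ j ∷ k ∷ [] → ∀ r → tabulate f ≡ insertAt xs r l →
    det (λ r s → S (f r) (f s)) ≡ + 3 -ᶻ + 2 *ᶻ weightAt i j k l
  det-insertAt f {i = i} {j} {k} {l} uniq refl r eq =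
    trans (det-at r eq) (cong (λ w → + 3 -ᶻ + 2 *ᶻ w) (move r))
    where
    moved : Fin 4 → ℤ
    moved zero                   = weightAt l i j k
    moved (suc zero)             = weightAt i l j k
    moved (suc (suc zero))       = weightAt i j l k
    moved (suc (suc (suc zero))) = weightAt i j k l

    det-at : ∀ r → tabulate f ≡ insertAt (i ∷ j ∷ k ∷ []) r l →
      det (λ r s → S (f r) (f s)) ≡ + 3 -ᶻ + 2 *ᶻ moved r
    det-at zero                   eq = det-weightAt f uniq eq
    det-at (suc zero)             eq = det-weightAt f uniq eq
    det-at (suc (suc zero))       eq = det-weightAt f uniq eq
    det-at (suc (suc (suc zero))) eq = det-weightAt f uniq eq

    move : ∀ r → moved r ≡ weightAt i j k l
    move zero rewrite symmetric i l | symmetric j l | symmetric k l =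
      solve 6 (λ a b c d e f → weightPolynomial c e f a b d := weightPolynomial a b c d e f) refl
        (S i j) (S i k) (S i l) (S j k) (S j l) (S k l)
    move (suc zero) rewrite symmetric j l | symmetric k l =
      solve 6 (λ a b c d e f → weightPolynomial c a b e f d := weightPolynomial a b c d e f) refl
        (S i j) (S i k) (S i l) (S j k) (S j l) (S k l)
    move (suc (suc zero)) rewrite symmetric k l =
      solve 6 (λ a b c d e f → weightPolynomial a c b e d f := weightPolynomial a b c d e f) refl
        (S i j) (S i k) (S i l) (S j k) (S j l) (S k l)
    move (suc (suc (suc zero))) = refl

  -- Hyperedges through a fixed triple

  module _ {τ : Subset v} {i j k} (τ≡ijk : members τ ≡ i ∷ j ∷ k ∷ []) where

    private
      uniq : Unique (i ∷ j ∷ k ∷ [])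
      uniq = subst Unique τ≡ijk (members-unique τ)

      ∣τ∣≡3 : ∣ τ ∣ ≡ 3
      ∣τ∣≡3 = trans (sym (length-tabulate (element τ))) (cong length τ≡ijk)

    weightAt-∈ : ∀ {l} → l ∈ τ → weightAt i j k l ≡ 1ℤ
    weightAt-∈ l∈τ = weightAt-inside uniq (subst (_ ∈ₗ_) τ≡ijk (∈⇒∈-members l∈τ))

    weightAt-∉ : ∀ {l} → l ∉ τ → weightAt i j k l ≡ + 3 ⊎ weightAt i j k l ≡ -1ℤ
    weightAt-∉ l∉τ =
      weightAt-outside uniq (l∉τ ∘ ∈-members⇒∈ ∘ subst (_ ∈ₗ_) (sym τ≡ijk))

    weightAt-value : ∀ l →
      weightAt i j k l ≡ + 3 ⊎ weightAt i j k l ≡ -1ℤ ⊎ weightAt i j k l ≡ 1ℤ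
    weightAt-value l with l ∈? τ
    ... | yes l∈τ = inj₂ (inj₂ (weightAt-∈ l∈τ))
    ... | no  l∉τ with weightAt-∉ l∉τ
    ...   | inj₁ w≡3  = inj₁ w≡3
    ...   | inj₂ w≡-1 = inj₂ (inj₁ w≡-1)

    weightAt≡1⇒∈ : ∀ {l} → weightAt i j k l ≡ 1ℤ → l ∈ τ
    weightAt≡1⇒∈ {l} w≡1 with l ∈? τ
    ... | yes l∈τ = l∈τ
    ... | no  l∉τ with weightAt-∉ l∉τ
    ...   | inj₁ w≡3  with () ← trans (sym w≡1) w≡3
    ...   | inj₂ w≡-1 with () ← trans (sym w≡1) w≡-1

    -- Weight 1 occurs exactly on `τ`, and two duplicate-free lists with the same elements are
    -- permutations of each other, hence equally long.
    count-1 : count (weightAt i j k) (allFin v) 1ℤ ≡ 3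
    count-1 = trans (↭-length (∼bag⇒↭ (unique∧set⇒bag
      (Unique.filter⁺ w≡1? (Unique.allFin⁺ v)) (members-unique τ) (mk⇔
        (∈⇒∈-members ∘ weightAt≡1⇒∈ ∘ proj₂ ∘ ∈-filter⁻ w≡1? {xs = allFin v})
        (λ l∈ → ∈-filter⁺ w≡1? (∈-allFin _) (weightAt-∈ (∈-members⇒∈ l∈)))))))
      (cong length τ≡ijk)
      where
      w≡1? = λ l → weightAt i j k l ℤ.≟ 1ℤ

    det-toggle : ∀ {l} → l ∉ τ → det (S [ toggle τ l ]) ≡ + 3 -ᶻ + 2 *ᶻ weightAt i j k l
    det-toggle {l} l∉τ with r , eq ← tabulate-toggle id τ l l∉τ =
      det-insertAt (element (toggle τ l)) (members-unique (toggle τ l)) τ≡ijk r eq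

    -- The map `toggle τ` sends the vertices of weight `c` bijectively to the hyperedges containing
    -- `τ`. One statement serves both designs, as 3 - 2c evaluates to 5 at c = -1 and to -3 at c =
    -- 3.
    count-edges : ∀ c → c ≢ 1ℤ →
      HasCount (λ α → Edge (𝓗 S 4 (+ 3 -ᶻ + 2 *ᶻ c)) α × τ ⊆ α)
               (count (weightAt i j k) (allFin v) c)
    count-edges c c≢1 =
      map (toggle τ) ls ,
      Unique.map⁺ (toggle-injective τ) (Unique.filter⁺ w≡c? (Unique.allFin⁺ v)) ,
      length-map (toggle τ) ls ,
      λ α → mk⇔ to from
      where
      w≡c? = λ l → weightAt i j k l ℤ.≟ c
      ls : List (Fin v)
      ls = filter w≡c? (allFin v)
      to : ∀ {α} → α ∈ₗ map (toggle τ) ls →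
        (∣ α ∣ ≡ 4 × det (S [ α ]) ≡ + 3 -ᶻ + 2 *ᶻ c) × τ ⊆ α
      to α∈ with l , l∈ls , refl ← ∈-map⁻ (toggle τ) α∈
        with _ , w≡c ← ∈-filter⁻ w≡c? {xs = allFin v} l∈ls =
        (trans (∣toggle∣ τ l l∉τ) (cong suc ∣τ∣≡3) ,
         trans (det-toggle l∉τ) (cong (λ w → + 3 -ᶻ + 2 *ᶻ w) w≡c)) ,
        ⊆-toggle l∉τ
        where
        l∉τ : l ∉ τ
        -- Members of `τ` have weight 1, so excluding that value keeps `l` outside and makes the
        -- toggle an insertion.
        l∉τ l∈τ = c≢1 (trans (sym w≡c) (weightAt-∈ l∈τ))
      from : ∀ {α} → (∣ α ∣ ≡ 4 × det (S [ α ]) ≡ + 3 -ᶻ + 2 *ᶻ c) × τ ⊆ α →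
        α ∈ₗ map (toggle τ) ls
      from ((∣α∣≡4 , det≡) , τ⊆α)
        with l , l∉τ , refl ← ⊆⇒toggle τ⊆α (trans ∣α∣≡4 (cong suc (sym ∣τ∣≡3))) =
        ∈-map⁺ (toggle τ) (∈-filter⁺ w≡c? (∈-allFin l)
          -- The minor determines the weight, because w ↦ 3 - 2w is injective on the integers.
          (ℤ.*-cancelˡ-≡ (+ 2) _ c (ℤ.neg-injective (+-cancelˡ (+ 3) _ _
            (trans (sym (det-toggle l∉τ)) det≡)))))

-- The two designs

three-members : ∀ (τ : Subset v) → ∣ τ ∣ ≡ 3 →
  ∃ λ i → ∃ λ j → ∃ λ k → members τ ≡ i ∷ j ∷ k ∷ []
three-members τ ∣τ∣≡3 with members τ | trans (length-tabulate (element τ)) ∣τ∣≡3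
... | i ∷ j ∷ k ∷ [] | _ = i , j , k , refl

mainTheorem3 : ∀ (n : ℕ) → 6 ≤ 4 * n + 2 →
    ∀ (S : Matrix (4 * n + 2)) → IsSymmetricConference S →
    IsDesign 3 (4 * n + 2) 4 (3 * n) (𝓗 S 4 (+ 5))
    × IsDesign 3 (4 * n + 2) 4 (n ∸ 1) (𝓗 S 4 (- (+ 3)))
mainTheorem3 n _ S C =
  (λ τ ∣τ∣≡3 → let _ , _ , _ , τ≡ijk = three-members τ ∣τ∣≡3 in
    subst (HasCount _) (proj₂ (counts τ≡ijk)) (count-edges C τ≡ijk -1ℤ (λ ()))) ,
  (λ τ ∣τ∣≡3 → let _ , _ , _ , τ≡ijk = three-members τ ∣τ∣≡3 in
    subst (HasCount _) (proj₁ (counts τ≡ijk)) (count-edges C τ≡ijk (+ 3) (λ ())))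
  where
  counts : ∀ {τ i j k} → members τ ≡ i ∷ j ∷ k ∷ [] →
    let # = count (weightAt C i j k) (allFin (4 * n + 2)) in
    # (+ 3) ≡ n ∸ 1 × # -1ℤ ≡ 3 * n
  counts {τ} {i} {j} {k} τ≡ijk
    with size , total ← value-counts (weightAt C i j k) id (weightAt-value C τ≡ijk)
    -- Replacing the count of weight 1 by 3 turns `size` and `total` into the linear system of
    -- `count-solution`, with left side 0 supplied by `sum-weightAt`.
    rewrite count-1 C τ≡ijk =
    count-solution n size (trans (sym (sum-weightAt C (subst Unique τ≡ijk (members-unique τ)))) total)
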